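{- Let $f_\omega$ be the infinite Fibonacci word and let $(w_n)_{n\ge -1}$ be its singular words. The closed $z$-factorization of $f_\omega$ is $$cz(f_\omega)=(w_{ -1},\,w_0,\,w_1,\,\ldots).$$
   Context: Finite Fibonacci words: $f_{ -1}=1$, $f_0=0$, $f_n=f_{n-1}f_{n-2}$ for $n\ge 1$ (words over $\{0,1\}$); $f_\omega=\lim_{n\to\infty} f_n$ is the infinite Fibonacci word. Singular words: $w_{ -2}=\varepsilon$ (empty word), $w_{ -1}=0$, $w_0=1$, and for $n\ge 1$, $w_n=a f_n b^{ -1}$ where $ab\in\{01,10\}$ is the length-2 suffix of $f_n$ (so $f_n b^{ -1}$ is $f_n$ with its last letter $b$ removed). A word $x$ is a border of $w$ if it is nonempty and both a prefix and a suffix of $w$. A nonempty finite word $w$ is closed if it is a single letter or it has a border $x$ that occurs exactly twice in $w$ (occurrences may overlap). The closed $z$-factorization of an infinite word $\boldsymbol w$ is the factorization $cz(\boldsymbol w)=(z_1,z_2,\ldots)$ with $\boldsymbol w=z_1z_2\cdots$, where for each $i$, $z_i$ is the shortest closed prefix of $z_iz_{i+1}\cdots$ that occurs exactly once in $z_1z_2\cdots z_i$. -}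

module Defs where

open import Data.Fin.Base using (Fin; zero; suc; fromℕ<; toℕ)
open import Data.Fin.Patterns using (0F; 1F)
open import Data.Fin.Properties using (toℕ-fromℕ<)
open import Data.List.Base
  using (List; []; _∷_; [_]; _++_; length; lookup; concat; reverse; applyUpTo)
open import Data.List.Properties
  using (length-++; reverse-++; unfold-reverse; reverse-involutive;
         applyUpTo-∷ʳ)
open import Data.List.Relation.Binary.Prefix.Heterogeneous
  using (Prefix; []; _∷_)
open import Data.List.Relation.Binary.Suffix.Heterogeneous using (Suffix)
open import Data.Nat.Base
  using (ℕ; zero; suc; _+_; _≤_; _<_; _≤′_; ≤′-refl; ≤′-step; z≤n; s≤s)
open import Data.Nat.Properties
  using (≤-antisym; ≤-total; ≤⇒≤′; +-mono-≤; +-comm)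
open import Data.Product.Base using (∃; ∃₂; _×_; _,_; proj₁)
open import Data.Product using (∃!)
open import Data.Sum.Base using (_⊎_; inj₁; inj₂)
open import Relation.Binary.PropositionalEquality
  using (_≡_; _≢_; refl; sym; trans; cong; cong₂; subst)

private
  variable
    A : Set

Word : Set → Set
Word = List

InfWord : Set → Set
InfWord A = ℕ → A

dropω : ℕ → InfWord A → InfWord A
dropω k w i = w (k + i)

infix 4 _≼ω_

_≼ω_ : Word A → InfWord A → Set
x ≼ω w = x ≡ applyUpTo w (length x)

-- Positions are 0-based; distinct occurrences may overlap.
OccursAt : Word A → Word A → ℕ → Set
OccursAt x w i = ∃₂ λ u v → w ≡ u ++ x ++ v × length u ≡ i

OccursOnce : Word A → Word A → Set
OccursOnce x w = ∃! _≡_ (OccursAt x w)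

OccursTwice : Word A → Word A → Set
OccursTwice x w = ∃₂ λ i j →
  i < j × OccursAt x w i × OccursAt x w j ×
  (∀ {k} → OccursAt x w k → k ≡ i ⊎ k ≡ j)

-- A word counts as a border of itself, as it satisfies the definition.
Border : Word A → Word A → Set
Border x w = x ≢ [] × Prefix _≡_ x w × Suffix _≡_ x w

Closed : Word A → Set
Closed w = (∃ λ a → w ≡ [ a ]) ⊎ (∃ λ x → Border x w × OccursTwice x w)

Shortest : (Word A → Set) → Word A → Set
Shortest P x = P x × (∀ {y} → P y → length x ≤ length y)

-- w = z 0 · z 1 · z 2 ⋯ ; the second component says that the product of the
-- z i is really infinite, so that it exhausts w.
Factorization : InfWord A → (ℕ → Word A) → Set
Factorization w z =
  (∀ n → concat (applyUpTo z n) ≼ω w) ×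
  (∀ k → ∃ λ n → k ≤ length (concat (applyUpTo z n)))

-- p is a possible next factor once the prefix u of w has been factorized.
ClosedZCandidate : InfWord A → Word A → Word A → Set
ClosedZCandidate w u p =
  p ≼ω dropω (length u) w × Closed p × OccursOnce p (u ++ p)

-- cz(w) = (z 0, z 1, z 2, …). The factors are indexed from 0 instead of 1.
IsClosedZFactorization : InfWord A → (ℕ → Word A) → Set
IsClosedZFactorization w z =
  Factorization w z ×
  (∀ i → Shortest (ClosedZCandidate w (concat (applyUpTo z i))) (z i))

isClosedZFactorization-unique :
  (w : InfWord A) {z z′ : ℕ → Word A} →
  IsClosedZFactorization w z → IsClosedZFactorization w z′ →
  ∀ i → z i ≡ z′ i
isClosedZFactorization-unique w {z} {z′} (_ , s) (_ , s′) i =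
  factor i (history i)
  where
  factor : ∀ n → applyUpTo z n ≡ applyUpTo z′ n → z n ≡ z′ n
  factor n eq with s n | s′ n
  ... | (c , least) | (c′ , least′) rewrite eq =
    trans (proj₁ c)
      (trans (cong (applyUpTo _) (≤-antisym (least c′) (least′ c)))
             (sym (proj₁ c′)))

  history : ∀ n → applyUpTo z n ≡ applyUpTo z′ n
  history zero    = refl
  history (suc n) =
    trans (sym (applyUpTo-∷ʳ z n))
      (trans (cong₂ (λ xs x → xs ++ [ x ]) (history n) (factor n (history n)))
             (applyUpTo-∷ʳ z′ n))

Letter : Set
Letter = Fin 2

-- Index shifted by one: fib k is f_{k-1}.
fib : ℕ → Word Letter
fib 0             = [ 1F ]
fib 1             = [ 0F ]
fib (suc (suc k)) = fib (suc k) ++ fib k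

1≤length-fib : ∀ k → 1 ≤ length (fib k)
1≤length-fib 0 = s≤s z≤n
1≤length-fib 1 = s≤s z≤n
1≤length-fib (suc (suc k)) =
  subst (1 ≤_) (sym (length-++ (fib (suc k))))
    (+-mono-≤ (1≤length-fib (suc k)) z≤n)

n<length-fib : ∀ n → n < length (fib (suc n))
n<length-fib zero    = s≤s z≤n
n<length-fib (suc n) =
  subst (suc (suc n) ≤_)
    (sym (trans (length-++ (fib (suc n))) (+-comm (length (fib (suc n))) _)))
    (+-mono-≤ (1≤length-fib n) (n<length-fib n))

-- The limit of the f_n: letter i can be read off f_i, which is longer than i.
-- By fib≼fibω below, every f_n with n ≥ 0 is a prefix of fibω.
fibω : InfWord Letter
fibω i = lookup (fib (suc i)) (fromℕ< (n<length-fib i))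

private
  prefix-refl : (xs : Word A) → Prefix _≡_ xs xs
  prefix-refl []       = []
  prefix-refl (x ∷ xs) = refl ∷ prefix-refl xs

  prefix-++ : {xs ys : Word A} (zs : Word A) →
              Prefix _≡_ xs ys → Prefix _≡_ xs (ys ++ zs)
  prefix-++ zs []       = []
  prefix-++ zs (e ∷ es) = e ∷ prefix-++ zs es

  fib-prefix : ∀ {m n} → m ≤′ n → Prefix _≡_ (fib (suc m)) (fib (suc n))
  fib-prefix ≤′-refl           = prefix-refl _
  fib-prefix (≤′-step {n} m≤n) = prefix-++ (fib n) (fib-prefix m≤n)

  lookup-prefix : {xs ys : Word A} → Prefix _≡_ xs ys →
                  ∀ i j → toℕ i ≡ toℕ j → lookup xs i ≡ lookup ys j
  lookup-prefix (e ∷ es) zero    zero    _  = e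
  lookup-prefix (e ∷ es) (suc i) (suc j) eq =
    lookup-prefix es i j (suc-inj eq)
    where
    suc-inj : ∀ {m n} → suc m ≡ suc n → m ≡ n
    suc-inj refl = refl

  ≼ω-pointwise : (xs : Word A) (w : InfWord A) →
                 (∀ i → lookup xs i ≡ w (toℕ i)) → xs ≼ω w
  ≼ω-pointwise []       w h = refl
  ≼ω-pointwise (x ∷ xs) w h =
    cong₂ _∷_ (h zero) (≼ω-pointwise xs (λ i → w (suc i)) (λ i → h (suc i)))

fib≼fibω : ∀ n → fib (suc n) ≼ω fibω
fib≼fibω n = ≼ω-pointwise (fib (suc n)) fibω agree
  where
  agree : ∀ i → lookup (fib (suc n)) i ≡ fibω (toℕ i)
  agree i with ≤-total n (toℕ i)
  ... | inj₁ n≤i = lookup-prefix (fib-prefix (≤⇒≤′ n≤i)) i _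
                     (sym (toℕ-fromℕ< (n<length-fib (toℕ i))))
  ... | inj₂ i≤n = sym (lookup-prefix (fib-prefix (≤⇒≤′ i≤n)) _ i
                     (toℕ-fromℕ< (n<length-fib (toℕ i))))

-- Sends x = u a b to a x b⁻¹ = a u a; words of length < 2 get a junk value.
singularize : Word A → Word A
singularize x with reverse x
... | b ∷ a ∷ r = a ∷ reverse (a ∷ r)
... | _         = []

singularize-++ : (u : Word A) (a b : A) →
                 singularize (u ++ a ∷ b ∷ []) ≡ a ∷ u ++ [ a ]
singularize-++ u a b
  rewrite reverse-++ u (a ∷ b ∷ []) =
  cong (a ∷_) (trans (unfold-reverse a (reverse u))
                     (cong (_++ [ a ]) (reverse-involutive u)))

-- Index shifted by one: singular k is w_{k-1}. The empty word w_{-2} is left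
-- out of the indexing.
singular : ℕ → Word Letter
singular 0             = [ 0F ]
singular 1             = [ 1F ]
singular (suc (suc k)) = singularize (fib (suc (suc k)))

{-# OPTIONS --safe #-}

-- For n ≥ 1 write f_n = c a b with letters a ≠ b, so that w_n = a c a.  The product
-- w_{-1} ⋯ w_{n-1} is f_{n+1} without its last letter, and appending a c to it
-- gives the word c″ with f_{n+2} = c″ a b.  As f_n f_{n-1} and f_{n-1} f_n differ
-- only in their last two letters, c″ starts with f_n and has period |f_n|, so all
-- its factors of length |f_n| are permutations of f_n.  But w_n has one more a than
-- f_n, so it does not occur in c″.  Hence
-- * w_n occurs only at the end of w_{-1} ⋯ w_n;
-- * w_n occurs in w_{n+2} = a c″ a only as a prefix and as a suffix, so that
--   w_{n+2} is closed.
-- Finally, a c occurs in w_{-1} ⋯ w_{n-1}, so no shorter prefix of w_n qualifies.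

module Submission where

open import Defs
open import Data.Empty using (⊥; ⊥-elim)
open import Data.Fin.Patterns using (0F; 1F)
open import Data.List.Base
  using ([]; _∷_; [_]; _∷ʳ_; _++_; length; concat; applyUpTo; initLast; _∷ʳ′_)
open import Data.List.Properties
  using (++-assoc; ++-identityʳ; ++-cancelʳ; length-++; ∷-injective; ∷-injectiveʳ;
         ∷ʳ-injectiveˡ; applyUpTo-∷ʳ; concat-++)
open import Data.List.Relation.Binary.Permutation.Propositional
  using (_↭_; ↭-refl; ↭-sym; ↭-trans; swap; module PermutationReasoning)
open import Data.List.Relation.Binary.Permutation.Propositional.Properties
  using (∷↭∷ʳ; drop-∷; shift; ↭-singleton-inv; ↭-length)
open import Data.List.Relation.Binary.Prefix.Heterogeneous as Prefix using (Prefix; []; fromView)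
open import Data.List.Relation.Binary.Pointwise using (≡⇒Pointwise-≡)
open import Data.List.Relation.Binary.Suffix.Heterogeneous using (Suffix; here; _++ˢ_)
open import Data.Nat.Base using (ℕ; zero; suc; _+_; _≤_; _<_; z≤n; s≤s)
open import Data.Nat.Properties
  using (+-suc; ≤-trans; ≤-pred; ≤-<-connex; m≤m+n; m≤n+m; n≤1+n; suc-injective; <⇒≢)
open import Data.Product.Base using (∃; _,_)
open import Data.Sum.Base using (_⊎_; inj₁; inj₂)
open import Relation.Binary.PropositionalEquality
  using (_≡_; _≢_; refl; sym; trans; cong; cong₂; subst; module ≡-Reasoning)
open import Relation.Nullary using (¬_)

private
  variable
    A : Set

-- Permutations and periods

∷-cancelʳ-↭ : ∀ (xs : Word A) {x y} → x ∷ xs ↭ y ∷ xs → x ≡ y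
∷-cancelʳ-↭ [] p with ↭-singleton-inv p
... | refl = refl
∷-cancelʳ-↭ (z ∷ xs) p =
  ∷-cancelʳ-↭ xs (drop-∷ (↭-trans (swap z _ ↭-refl) (↭-trans p (swap _ z ↭-refl))))

-- The hypothesis g t = t h says that g t has period |g|.
window-↭ : ∀ (y x z g t h : Word A) → g ++ t ≡ t ++ h → y ++ x ++ z ≡ g ++ t →
           length x ≡ length g → x ↭ g
window-↭ [] x z g t h _ eq len = subst (_↭ g) (sym (same x g eq len)) ↭-refl
  where
  same : ∀ (x g : Word _) → x ++ z ≡ g ++ t → length x ≡ length g → x ≡ g
  same []       []       _  _   = refl
  same (a ∷ x) (b ∷ g) eq len with ∷-injective eq
  ... | refl , eq′ = cong (a ∷_) (same x g eq′ (suc-injective len))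
window-↭ (c ∷ y) [] z [] t h _ eq len = ↭-refl
-- If `t` is empty, the whole word is only as long as `x`, so nothing can precede `x`.
window-↭ (c ∷ y) x z (d ∷ g) [] h _ eq len = ⊥-elim (<⇒≢ longer (sym (cong length eq)))
  where
  longer : length (d ∷ g ++ []) < length (c ∷ y ++ x ++ z)
  longer rewrite ++-identityʳ g | sym len | length-++ y {x ++ z} | length-++ x {z} =
    s≤s (≤-trans (m≤m+n _ _) (m≤n+m _ (length y)))
-- By the period, `t` also starts with `d`. Deleting the leading `d` of the word thus turns `g` into
-- its rotation `g ∷ʳ d`, again a period word and a permutation of `g`.
window-↭ (c ∷ y) x z (d ∷ g) (e ∷ t) h per eq len with ∷-injective per
... | refl , per′ =
  ↭-trans
    (window-↭ y x z (g ∷ʳ d) t h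
      (trans shifted per′) (trans (∷-injectiveʳ eq) (sym shifted))
      (trans len (↭-length (∷↭∷ʳ d g))))
    (↭-sym (∷↭∷ʳ d g))
  where
  shifted : (g ∷ʳ d) ++ t ≡ g ++ d ∷ t
  shifted = ++-assoc g [ d ] t

-- Occurrences and closed words

Occurs : Word A → Word A → Set
Occurs x w = ∃ (OccursAt x w)

occurs : ∀ (u x v : Word A) {w} → w ≡ u ++ x ++ v → OccursAt x w (length u)
occurs u x v eq = u , v , eq , refl

position-of-suffix : ∀ (u v x : Word A) → u ++ x ≡ v ++ x → length u ≡ length v
position-of-suffix u v x eq = cong length (++-cancelʳ x u v eq)

-- An occurrence in s b that does not reach b is an occurrence in s.
occursAt-∷ʳ : ∀ {x s w : Word A} {b k} (p : Word A) → ¬ Occurs x s →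
              w ≡ s ∷ʳ b → w ≡ p ++ x → OccursAt x w k → k ≡ length p
occursAt-∷ʳ {x = x} p x∉s eq w≡px (u , v , w≡uxv , refl) with initLast v
... | [] = position-of-suffix u p x
             (trans (cong (u ++_) (sym (++-identityʳ x))) (trans (sym w≡uxv) w≡px))
... | v′ ∷ʳ′ c =
  ⊥-elim (x∉s (_ , occurs u x v′ (∷ʳ-injectiveˡ _ _ (trans (sym eq) (trans w≡uxv assoc)))))
  where
  assoc : u ++ x ++ v′ ∷ʳ c ≡ (u ++ x ++ v′) ∷ʳ c
  assoc = trans (cong (u ++_) (sym (++-assoc x v′ [ c ]))) (sym (++-assoc u (x ++ v′) [ c ]))

occursOnce-∷ʳ : ∀ {x s : Word A} {b} (p : Word A) → ¬ Occurs x s →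
                p ++ x ≡ s ∷ʳ b → OccursOnce x (p ++ x)
occursOnce-∷ʳ {x = x} p x∉s eq =
  length p , occurs p x [] (cong (p ++_) (sym (++-identityʳ x))) ,
  λ occ → sym (occursAt-∷ʳ p x∉s eq refl occ)

-- An occurrence of `x` away from position 0 lies in `s ∷ʳ b`; as `x` is not in `s`, it must be the
-- final one. The leading `d` keeps the prefix and the suffix occurrence apart.
closed-from-border : ∀ {a b c d : A} {x s u v w : Word A} → x ≢ [] → ¬ Occurs x s →
                     w ≡ a ∷ s ∷ʳ b → w ≡ x ++ c ∷ v → w ≡ d ∷ u ++ x → Closed w
closed-from-border {c = c} {d} {x} {s} {u} {v} {w} x≢[] x∉s eq pre suf =
  inj₂ (x , (x≢[] , prefix , suffix) ,
        0 , suc (length u) , s≤s z≤n ,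
        occurs [] x (c ∷ v) pre ,
        occurs (d ∷ u) x [] (trans suf (cong ((d ∷ u) ++_) (sym (++-identityʳ x)))) ,
        only)
  where
  prefix : Prefix _≡_ x w
  prefix = subst (Prefix _≡_ x) (sym pre) (fromView (≡⇒Pointwise-≡ refl Prefix.++ (c ∷ v)))
  suffix : Suffix _≡_ x w
  suffix = subst (Suffix _≡_ x) (sym suf) ((d ∷ u) ++ˢ here (≡⇒Pointwise-≡ refl))
  only : ∀ {k} → OccursAt x w k → k ≡ 0 ⊎ k ≡ suc (length u)
  only ([] , _ , _ , refl) = inj₁ refl
  only (e ∷ u′ , v′ , w≡uxv , refl) =
    inj₂ (cong suc (occursAt-∷ʳ u x∉s (∷-injectiveʳ (trans (sym w≡uxv) eq))
                                       (∷-injectiveʳ (trans (sym w≡uxv) suf))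
                                       (occurs u′ x v′ refl)))

-- Prefixes of infinite words

≼ω-++⁻ˡ : ∀ (xs {ys} : Word A) (w : InfWord A) → xs ++ ys ≼ω w → xs ≼ω w
≼ω-++⁻ˡ []       w eq = refl
≼ω-++⁻ˡ (x ∷ xs) w eq with ∷-injective eq
... | e , es = cong₂ _∷_ e (≼ω-++⁻ˡ xs (dropω 1 w) es)

≼ω-++⁻ʳ : ∀ (xs {ys} : Word A) (w : InfWord A) → xs ++ ys ≼ω w → ys ≼ω dropω (length xs) w
≼ω-++⁻ʳ []       w eq = eq
≼ω-++⁻ʳ (x ∷ xs) w eq = ≼ω-++⁻ʳ xs (dropω 1 w) (∷-injectiveʳ eq)

≼ω-prefix : ∀ (xs ys : Word A) (w : InfWord A) → xs ≼ω w → ys ≼ω w → length xs ≤ length ys →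
            ∃ λ zs → ys ≡ xs ++ zs
≼ω-prefix []       ys       w _  _  _ = ys , refl
≼ω-prefix (x ∷ xs) (y ∷ ys) w ex ey (s≤s le)
  with ∷-injective ex | ∷-injective ey
... | refl , ex′ | refl , ey′ with ≼ω-prefix xs ys (dropω 1 w) ex′ ey′ le
... | zs , eq = zs , cong (x ∷_) eq

closed⇒nonempty : ∀ {w : Word A} → Closed w → 1 ≤ length w
closed⇒nonempty {w = _ ∷ _} _ = s≤s z≤n
closed⇒nonempty {w = []} (inj₁ (_ , ()))
closed⇒nonempty {w = []} (inj₂ (_ , (x≢[] , [] , _) , _)) = ⊥-elim (x≢[] refl)

-- Fibonacci, central and singular words

-- central k and letter k are the c and the a of f_{k+1} = c a b; the letter b is
-- then letter (suc k).
letter : ℕ → Letter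
letter 0             = 0F
letter 1             = 1F
letter (suc (suc k)) = letter k

letter-alternates : ∀ k → letter k ≢ letter (suc k)
letter-alternates 0             ()
letter-alternates 1             ()
letter-alternates (suc (suc k)) = letter-alternates k

central : ℕ → Word Letter
central 0             = []
central 1             = [ 0F ]
central (suc (suc k)) = central (suc k) ++ letter (suc k) ∷ letter k ∷ central k

fib-central : ∀ k → fib (2 + k) ≡ central k ++ letter k ∷ letter (suc k) ∷ []
fib-central 0 = refl
fib-central 1 = refl
fib-central (suc (suc k)) =
  trans (cong₂ _++_ (fib-central (suc k)) (fib-central k))
  (trans (++-assoc (central (suc k)) _ _)
         (sym (++-assoc (central (suc k)) _ _)))

singular-central : ∀ k → singular (2 + k) ≡ letter k ∷ central k ∷ʳ letter k
singular-central k =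
  trans (cong singularize (fib-central k)) (singularize-++ (central k) _ _)

-- The near-commutation of consecutive Fibonacci words, with the two differing last letters
-- stripped. The induction step unfolds the first central word by definition and refolds the tail by
-- the induction hypothesis.
central-comm : ∀ k → central (2 + k) ≡ central k ++ letter k ∷ letter (suc k) ∷ central (suc k)
central-comm zero    = refl
central-comm (suc k) = begin
  central (2 + k) ++ letter k ∷ letter (suc k) ∷ central (suc k)
    ≡⟨ ++-assoc (central (suc k)) _ _ ⟩
  central (suc k) ++ letter (suc k) ∷ letter k ∷
    central k ++ letter k ∷ letter (suc k) ∷ central (suc k)
    ≡⟨ cong (λ u → central (suc k) ++ letter (suc k) ∷ letter k ∷ u) (central-comm k) ⟨
  central (suc k) ++ letter (suc k) ∷ letter k ∷ central (2 + k) ∎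
  where open ≡-Reasoning

-- In place of counting letters: cancelling `c` and one `a` on both sides leaves `a` against `b`.
not-conjugate : ∀ (c : Word A) {a b} → a ≢ b → ¬ (a ∷ c ∷ʳ a ↭ c ++ a ∷ b ∷ [])
not-conjugate c {a} {b} a≢b p = a≢b (∷-cancelʳ-↭ c (drop-∷ (begin
  a ∷ a ∷ c          ↭⟨ ∷↭∷ʳ a (a ∷ c) ⟩
  a ∷ c ∷ʳ a         ↭⟨ p ⟩
  c ++ a ∷ b ∷ []    ↭⟨ shift a c [ b ] ⟩
  a ∷ c ∷ʳ b         ↭⟨ ∷↭∷ʳ b (a ∷ c) ⟨
  b ∷ a ∷ c          ↭⟨ swap b a ↭-refl ⟩
  a ∷ b ∷ c          ∎)))
  where open PermutationReasoning

singular∉central : ∀ k → ¬ Occurs (singular (2 + k)) (central (2 + k))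
singular∉central k (_ , u , v , eq , _) rewrite singular-central k =
  not-conjugate (central k) (letter-alternates k)
    -- The period word `g` is f_{k+1}. The two sides of the period equation are the two
    -- decompositions of `central (2 + k)`, by `central-comm` and by definition.
    (window-↭ u _ v g (central (suc k)) (letter (suc k) ∷ letter k ∷ central k)
      (sym starts) (trans (sym eq) starts) len)
  where
  g = central k ++ letter k ∷ letter (suc k) ∷ []
  starts : central (2 + k) ≡ g ++ central (suc k)
  starts = trans (central-comm k) (sym (++-assoc (central k) _ _))
  len : length (letter k ∷ central k ∷ʳ letter k) ≡ length g
  len rewrite length-++ (central k) {[ letter k ]}
            | length-++ (central k) {letter k ∷ letter (suc k) ∷ []} = sym (+-suc _ 1)

-- From w_1 on, the border of w_n is w_{n-2}. For w_1 = 00 and w_2 = 101 it is a single letter, out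
-- of reach of `singular∉central`, so these cases are checked by hand.
closed-singular : ∀ k → Closed (singular k)
closed-singular 0 = inj₁ (_ , refl)
closed-singular 1 = inj₁ (_ , refl)
closed-singular 2 =
  closed-from-border {x = [ 0F ]} {s = []} {u = []} (λ ()) no refl refl refl
  where
  no : ¬ Occurs _ _
  no (_ , [] , _ , () , _)
  no (_ , _ ∷ _ , _ , () , _)
closed-singular 3 =
  closed-from-border {x = [ 1F ]} {s = [ 0F ]} {u = [ 0F ]} (λ ()) no refl refl refl
  where
  no : ¬ Occurs _ _
  no (_ , [] , _ , () , _)
  no (_ , _ ∷ [] , _ , () , _)
  no (_ , _ ∷ _ ∷ _ , _ , () , _)
closed-singular (suc (suc (suc (suc k)))) =
  closed-from-border {x = singular (2 + k)} nonempty (singular∉central k)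
    (singular-central (2 + k)) begins ends
  where
  nonempty : singular (2 + k) ≢ []
  nonempty eq with trans (sym (singular-central k)) eq
  ... | ()
  open ≡-Reasoning
  -- Inside a c″ a, the decomposition of c″ by `central-comm` exposes the border as a prefix; in
  -- `ends`, the defining one exposes it as a suffix.
  begins : singular (4 + k) ≡ singular (2 + k) ++ letter (suc k) ∷ central (suc k) ∷ʳ letter k
  begins = begin
    singular (4 + k)
      ≡⟨ singular-central (2 + k) ⟩
    letter k ∷ central (2 + k) ∷ʳ letter k
      ≡⟨ cong (λ u → letter k ∷ u ∷ʳ letter k) (central-comm k) ⟩
    letter k ∷ (central k ++ letter k ∷ letter (suc k) ∷ central (suc k)) ∷ʳ letter k
      ≡⟨ cong (letter k ∷_) (++-assoc (central k) _ _) ⟩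
    letter k ∷ central k ++ letter k ∷ letter (suc k) ∷ central (suc k) ∷ʳ letter k
      ≡⟨ cong (letter k ∷_) (++-assoc (central k) [ letter k ] _) ⟨
    (letter k ∷ central k ∷ʳ letter k) ++ letter (suc k) ∷ central (suc k) ∷ʳ letter k
      ≡⟨ cong (_++ letter (suc k) ∷ central (suc k) ∷ʳ letter k) (singular-central k) ⟨
    singular (2 + k) ++ letter (suc k) ∷ central (suc k) ∷ʳ letter k ∎
  ends : singular (4 + k) ≡ letter k ∷ (central (suc k) ∷ʳ letter (suc k)) ++ singular (2 + k)
  ends = begin
    singular (4 + k)
      ≡⟨ singular-central (2 + k) ⟩
    letter k ∷ central (2 + k) ∷ʳ letter k
      ≡⟨ cong (letter k ∷_) (++-assoc (central (suc k)) _ _) ⟩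
    letter k ∷ central (suc k) ++ letter (suc k) ∷ letter k ∷ central k ∷ʳ letter k
      ≡⟨ cong (λ u → letter k ∷ central (suc k) ++ letter (suc k) ∷ u) (singular-central k) ⟨
    letter k ∷ central (suc k) ++ letter (suc k) ∷ singular (2 + k)
      ≡⟨ cong (letter k ∷_) (++-assoc (central (suc k)) [ letter (suc k) ] _) ⟨
    letter k ∷ (central (suc k) ∷ʳ letter (suc k)) ++ singular (2 + k) ∎

-- Products of singular words

prod : ℕ → Word Letter
prod n = concat (applyUpTo singular n)

prod-suc : ∀ n → prod (suc n) ≡ prod n ++ singular n
prod-suc n = begin
  concat (applyUpTo singular (suc n))            ≡⟨ cong concat (applyUpTo-∷ʳ singular n) ⟨
  concat (applyUpTo singular n ∷ʳ singular n)    ≡⟨ concat-++ (applyUpTo singular n) _ ⟨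
  prod n ++ (singular n ++ [])                   ≡⟨ cong (prod n ++_) (++-identityʳ _) ⟩
  prod n ++ singular n                           ∎
  where open ≡-Reasoning

-- The form of `prod (2 + k)` is an argument so that the computation serves both as induction step
-- of `prod-central` and in `occursOnce-singular`.
prod-central-++ : ∀ k → prod (2 + k) ≡ central (suc k) ∷ʳ letter (suc k) →
                  prod (2 + k) ++ singular (2 + k) ≡ central (2 + k) ∷ʳ letter k
prod-central-++ k eq = begin
  prod (2 + k) ++ singular (2 + k)
    ≡⟨ cong₂ _++_ eq (singular-central k) ⟩
  (central (suc k) ∷ʳ letter (suc k)) ++ letter k ∷ central k ∷ʳ letter k
    ≡⟨ ++-assoc (central (suc k)) _ _ ⟩
  central (suc k) ++ letter (suc k) ∷ letter k ∷ central k ∷ʳ letter k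
    ≡⟨ ++-assoc (central (suc k)) _ _ ⟨
  central (2 + k) ∷ʳ letter k ∎
  where open ≡-Reasoning

prod-central : ∀ k → prod (2 + k) ≡ central (suc k) ∷ʳ letter (suc k)
prod-central zero    = refl
prod-central (suc k) = trans (prod-suc (2 + k)) (prod-central-++ k (prod-central k))

fib-prod : ∀ k → fib (3 + k) ≡ prod (2 + k) ∷ʳ letter k
fib-prod k = begin
  fib (3 + k)                                           ≡⟨ fib-central (suc k) ⟩
  central (suc k) ++ letter (suc k) ∷ letter k ∷ []     ≡⟨ ++-assoc (central (suc k)) _ _ ⟨
  (central (suc k) ∷ʳ letter (suc k)) ∷ʳ letter k       ≡⟨ cong (_∷ʳ letter k) (prod-central k) ⟨
  prod (2 + k) ∷ʳ letter k                              ∎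
  where open ≡-Reasoning

prod≼fibω : ∀ n → prod n ≼ω fibω
prod≼fibω 0 = refl
prod≼fibω 1 = refl
prod≼fibω (suc (suc k)) =
  ≼ω-++⁻ˡ (prod (2 + k)) fibω (subst (_≼ω fibω) (fib-prod k) (fib≼fibω (2 + k)))

-- For the exhaustion clause of `Factorization`: f_{k+2} has at least `3 + k` letters, and the
-- product lacks just one of them.
prod-long : ∀ k → k ≤ length (prod (2 + k))
prod-long k = ≤-pred (≤-trans (n≤1+n _) (≤-trans (n≤1+n _)
                     (subst (3 + k ≤_) len (n<length-fib (2 + k)))))
  where
  len : length (fib (3 + k)) ≡ suc (length (prod (2 + k)))
  len = trans (cong length (fib-prod k)) (sym (↭-length (∷↭∷ʳ (letter k) (prod (2 + k)))))

singular≼fibω : ∀ n → singular n ≼ω dropω (length (prod n)) fibω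
singular≼fibω n = ≼ω-++⁻ʳ (prod n) fibω (subst (_≼ω fibω) (prod-suc n) (prod≼fibω (suc n)))

-- Uniqueness of occurrence and minimality

occursOnce-singular : ∀ n → OccursOnce (singular n) (prod n ++ singular n)
occursOnce-singular 0 = occursOnce-∷ʳ {s = []} [] no refl
  where
  no : ¬ Occurs _ _
  no (_ , [] , _ , () , _)
  no (_ , _ ∷ _ , _ , () , _)
occursOnce-singular 1 = occursOnce-∷ʳ {s = [ 0F ]} [ 0F ] no refl
  where
  no : ¬ Occurs _ _
  no (_ , [] , _ , () , _)
  no (_ , _ ∷ [] , _ , () , _)
  no (_ , _ ∷ _ ∷ _ , _ , () , _)
occursOnce-singular (suc (suc k)) =
  occursOnce-∷ʳ (prod (2 + k)) (singular∉central k) (prod-central-++ k (prod-central k))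

-- Every proper prefix of the next factor a c a is a prefix of a c, so one earlier occurrence of a c
-- rules them all out.
occurs-before : ∀ k → ∃ λ q → prod (2 + k) ≡ q ++ (letter k ∷ central k) ++ [ letter (suc k) ]
occurs-before zero    = [] , refl
occurs-before (suc k) = central k ∷ʳ letter k , (begin
  prod (3 + k)                   ≡⟨ prod-central (suc k) ⟩
  central (2 + k) ∷ʳ letter k    ≡⟨ cong (_∷ʳ letter k) (central-comm k) ⟩
  (central k ++ letter k ∷ letter (suc k) ∷ central (suc k)) ∷ʳ letter k
                                 ≡⟨ ++-assoc (central k) _ _ ⟩
  central k ++ letter k ∷ letter (suc k) ∷ central (suc k) ∷ʳ letter k
                                 ≡⟨ ++-assoc (central k) _ _ ⟨
  (central k ∷ʳ letter k) ++ letter (suc k) ∷ central (suc k) ∷ʳ letter k ∎)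
  where open ≡-Reasoning

-- One occurrence of `y` starts after `q`, another after `p`. The final `b` makes `q` strictly
-- shorter than `p`, even when `y` is empty.
¬occursOnce : ∀ (q y z : Word A) {b p} → p ≡ q ++ (y ++ z) ∷ʳ b → ¬ OccursOnce y (p ++ y)
¬occursOnce q y z {b} {p} eq (i , _ , unique) =
  <⇒≢ shorter (trans (sym (unique (occurs q y ((z ∷ʳ b) ++ y) early)))
                     (unique (occurs p y [] (cong (p ++_) (sym (++-identityʳ y))))))
  where
  open ≡-Reasoning
  early : p ++ y ≡ q ++ y ++ (z ∷ʳ b) ++ y
  early = begin
    p ++ y                          ≡⟨ cong (_++ y) eq ⟩
    (q ++ (y ++ z) ∷ʳ b) ++ y       ≡⟨ ++-assoc q _ y ⟩
    q ++ ((y ++ z) ∷ʳ b) ++ y       ≡⟨ cong (λ u → q ++ u ++ y) (++-assoc y z [ b ]) ⟩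
    q ++ (y ++ z ∷ʳ b) ++ y         ≡⟨ cong (q ++_) (++-assoc y _ y) ⟩
    q ++ y ++ (z ∷ʳ b) ++ y         ∎
  shorter : length q < length p
  shorter rewrite eq | length-++ q {(y ++ z) ∷ʳ b} | sym (↭-length (∷↭∷ʳ b (y ++ z)))
                | +-suc (length q) (length (y ++ z)) = s≤s (m≤m+n _ _)

least-singular : ∀ n {y} → ClosedZCandidate fibω (prod n) y → length (singular n) ≤ length y
least-singular 0 (_ , closed , _) = closed⇒nonempty closed
least-singular 1 (_ , closed , _) = closed⇒nonempty closed
least-singular (suc (suc k)) {y} (y≼ , _ , once)
  with ≤-<-connex (length (singular (2 + k))) (length y)
... | inj₁ le = le
... | inj₂ y<s = ⊥-elim absurd
  where
  rest : InfWord Letter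
  rest = dropω (length (prod (2 + k))) fibω
  s≼ : (letter k ∷ central k) ∷ʳ letter k ≼ω rest
  s≼ = subst (_≼ω rest) (singular-central k) (singular≼fibω (2 + k))
  len : length (singular (2 + k)) ≡ suc (length (letter k ∷ central k))
  len = trans (cong length (singular-central k))
              (sym (↭-length (∷↭∷ʳ (letter k) (letter k ∷ central k))))
  absurd : ⊥
  -- A shorter candidate is at most as long as a c, and both are prefixes of `rest`, so `y` is a
  -- prefix of a c.
  absurd with ≼ω-prefix y (letter k ∷ central k) rest y≼
                       (≼ω-++⁻ˡ (letter k ∷ central k) rest s≼)
                       (≤-pred (subst (suc (length y) ≤_) len y<s))
                   | occurs-before k
  ... | z , ac≡yz | q , eq =
    ¬occursOnce q y z (trans eq (cong (λ u → q ++ u ∷ʳ letter (suc k)) ac≡yz)) once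

theorem5 : IsClosedZFactorization fibω singular
theorem5 =
  (prod≼fibω , λ k → 2 + k , prod-long k) ,
  λ n → (singular≼fibω n , closed-singular n , occursOnce-singular n) , least-singular n
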